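{- Let $G$ be a maximal outerplanar graph of order $n\geq 3$, and let $t$ be the number of vertices of degree $2$ in $G$. Then $\gamma_{\times 2}(G)\leq \lfloor \frac{n+t}{2}\rfloor$. -}

module Defs where

open import Data.Fin using (Fin; _<_; _≟_)
open import Data.Fin.Permutation using (Permutation′; _⟨$⟩ʳ_)
open import Data.Fin.Subset using (Subset; ∣_∣; _∩_)
open import Data.Nat as ℕ using (ℕ; _≤_)
open import Data.Product using (_×_; _,_; ∃-syntax)
open import Data.Sum using (_⊎_; inj₁; inj₂)
open import Data.Vec using (tabulate)
open import Level using (0ℓ)
open import Relation.Binary using (Rel; Symmetric; Decidable)
open import Relation.Binary.PropositionalEquality using (_≡_; _≢_; refl)
open import Relation.Nullary using (¬_; does; _×-dec_; _⊎-dec_)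
import Relation.Unary as U

record Graph (n : ℕ) : Set₁ where
  field
    Adj        : Rel (Fin n) 0ℓ
    adj?       : Decidable Adj
    adj-sym    : Symmetric Adj
    adj-irrefl : ∀ {v} → ¬ Adj v v

open Graph public

private
  variable
    n : ℕ

addEdge : Graph n → (u v : Fin n) → u ≢ v → Graph n
addEdge G u v u≢v = record
  { Adj        = λ x y → Adj G x y ⊎ (x ≡ u × y ≡ v) ⊎ (x ≡ v × y ≡ u)
  ; adj?       = λ x y → adj? G x y ⊎-dec ((x ≟ u ×-dec y ≟ v) ⊎-dec (x ≟ v ×-dec y ≟ u))
  ; adj-sym    = λ { (inj₁ e)                   → inj₁ (adj-sym G e)
                   ; (inj₂ (inj₁ (x≡u , y≡v))) → inj₂ (inj₂ (y≡v , x≡u))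
                   ; (inj₂ (inj₂ (x≡v , y≡u))) → inj₂ (inj₁ (y≡u , x≡v)) }
  ; adj-irrefl = λ { (inj₁ e)                       → adj-irrefl G e
                   ; (inj₂ (inj₁ (refl , refl))) → u≢v refl
                   ; (inj₂ (inj₂ (refl , refl))) → u≢v refl }
  }

-- An outerplanar drawing puts all vertices on the boundary of the outer face,
-- so the edges are drawn in a closed disc with the vertices on its bounding
-- circle.  Such a drawing is recorded by the cyclic arrangement π of the
-- vertices (positions 0, 1, …, n-1 around the circle).  Two edges ac and bd
-- are forced to cross exactly when their ends alternate around the circle;
-- since adjacency is symmetric, the alternation may be read off starting at
-- the end with the smallest position.
NonCrossing : Graph n → Permutation′ n → Set
NonCrossing G π = ∀ {a b c d} → Adj G a c → Adj G b d →
  ¬ (π ⟨$⟩ʳ a < π ⟨$⟩ʳ b × π ⟨$⟩ʳ b < π ⟨$⟩ʳ c × π ⟨$⟩ʳ c < π ⟨$⟩ʳ d)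

Outerplanar : Graph n → Set
Outerplanar {n} G = ∃[ π ] NonCrossing {n} G π

MaximalOuterplanar : Graph n → Set
MaximalOuterplanar G = Outerplanar G ×
  (∀ u v (u≢v : u ≢ v) → ¬ Adj G u v → ¬ Outerplanar (addEdge G u v u≢v))

subsetOf : {P : U.Pred (Fin n) 0ℓ} → U.Decidable P → Subset n
subsetOf P? = tabulate (λ v → does (P? v))

N⟨_⟩ : Graph n → Fin n → Subset n
N⟨ G ⟩ v = subsetOf (adj? G v)

N[_] : Graph n → Fin n → Subset n
N[ G ] v = subsetOf (λ u → (u ≟ v) ⊎-dec adj? G v u)

degree : Graph n → Fin n → ℕ
degree G v = ∣ N⟨ G ⟩ v ∣

#degree2 : Graph n → ℕ
#degree2 G = ∣ subsetOf (λ v → degree G v ℕ.≟ 2) ∣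

DoubleDominating : Graph n → Subset n → Set
DoubleDominating G S = ∀ v → 2 ≤ ∣ N[ G ] v ∩ S ∣

-- γ×₂ G ≡ k.  A relation rather than a function, because a graph with an
-- isolated vertex has no double dominating set at all.
IsDoubleDominationNumber : Graph n → ℕ → Set
IsDoubleDominationNumber G k =
  (∃[ S ] DoubleDominating G S × ∣ S ∣ ≡ k) ×
  (∀ S → DoubleDominating G S → k ≤ ∣ S ∣)

{-# OPTIONS --safe #-}
module Submission where

-- A maximal outerplanar graph is a triangulated polygon.  Following its dual
-- tree, 2-colour the vertices so that no triangle is monochromatic and any two
-- triangles sharing an edge have two vertices of each colour.  A vertex of
-- degree at least 3 lies in two such triangles, so it sees both colours twice
-- in its closed neighbourhood; a vertex of degree 2 sees one colour twice and
-- the other once.  Hence each colour class becomes double dominating after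
-- adding one vertex for each degree-2 vertex that sees it only once, and the
-- sizes of the two resulting sets add up to at most n + t.

open import Data.Bool using (Bool; true; false; not; _xor_; if_then_else_)
import Data.Bool as Bool
import Data.Bool.Properties as Bool
open import Data.Empty using (⊥; ⊥-elim)
open import Data.Fin as Fin using (Fin; toℕ)
open import Data.Fin.Permutation using (Permutation′; _⟨$⟩ʳ_; _⟨$⟩ˡ_; inverseʳ)
import Data.Fin.Properties as Fin
open import Data.Fin.Subset as Subset using (Subset; inside; outside; ∣_∣; _∈_; _∉_; _⊆_; _∪_; _∩_; ⁅_⁆; ⊤)
open import Data.Fin.Subset.Properties
open import Data.Nat as Nat using (ℕ; zero; suc; _+_; _≤_; _<_; _≤?_; z≤n; s≤s; ⌊_/2⌋)
import Data.Nat.Properties as ℕ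
open import Algebra.Properties.CommutativeSemigroup ℕ.+-commutativeSemigroup using (interchange)
open import Data.Product using (_×_; _,_; ∃-syntax)
open import Data.Sum using (_⊎_; inj₁; inj₂)
open import Data.Vec using ([]; _∷_; here; there)
open import Data.Vec.Properties using (lookup∘tabulate; []=⇒lookup; lookup⇒[]=)
open import Function using (id; _∘_; Injection)
open import Function.Properties.Inverse using (↔⇒↣)
open import Level using (0ℓ)
open import Relation.Binary.Definitions using (tri<; tri≈; tri>)
open import Relation.Binary.PropositionalEquality using (_≡_; _≢_; refl; sym; trans; cong; subst)
open import Relation.Nullary using (¬_; Dec; yes; no; does; contradiction; _×-dec_; _⊎-dec_)
open import Relation.Nullary.Decidable using (dec-true; dec-false)
import Relation.Unary as U
open import Defs

-- Colour counts in a set of vertices, and mixed triples of colours.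

Two : {V : Set} → (V → Set) → (V → Bool) → Bool → Set
Two P c b = ∃[ x ] ∃[ y ] x ≢ y × (P x × c x ≡ b) × (P y × c y ≡ b)

One : {V : Set} → (V → Set) → (V → Bool) → Bool → Set
One P c b = ∃[ x ] P x × c x ≡ b

Full : {V : Set} → (V → Set) → (V → Bool) → Set
Full P c = ∀ b → Two P c b

Lopsided : {V : Set} → (V → Set) → (V → Bool) → Set
Lopsided P c = ∃[ b ] Two P c b × One P c (not b)

module _ {V W : Set} {P : V → Set} {c : V → Bool} {Q : W → Set} {d : W → Bool}
         (f : W → V) (lift : ∀ {x} → P x → ∃[ w ] f w ≡ x × Q w × d w ≡ c x) where

  One-lift : ∀ {b} → One P c b → One Q d b
  One-lift (x , px , cx) with lift px
  ... | w , _ , qw , dw = w , qw , trans dw cx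

  -- Distinct witnesses have distinct lifts, because `f` sends the lifts back to them. Used with
  -- `f = id` to enlarge an interval and with `f = pos` to pass from positions to vertices.
  Two-lift : ∀ {b} → Two P c b → Two Q d b
  Two-lift (x , y , x≢y , (px , cx) , (py , cy)) with lift px | lift py
  ... | u , refl , qu , du | w , refl , qw , dw =
    u , w , (λ { refl → x≢y refl }) , (qu , trans du cx) , (qw , trans dw cy)

  Lopsided-lift : Lopsided P c → Lopsided Q d
  Lopsided-lift (b , two , one) = b , Two-lift two , One-lift one

Mixed : Bool → Bool → Bool → Set
Mixed p q r = ¬ (p ≡ q × q ≡ r)

-- For a mixed triple, the colour that completes it to two of each.
fourth : Bool → Bool → Bool → Bool
fourth p q r = p xor (q xor r)

-- A monochromatic triple would force `p ≡ r`; these two then cancel in the `xor`, and the fourth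
-- colour is `q`, which differs from `p`. Hence mixedness passes on to the next triangle.
Mixed-fourthˡ : ∀ p q r → Mixed p q r → Mixed p r (fourth p q r)
Mixed-fourthˡ true  true  true  mix = ⊥-elim (mix (refl , refl))
Mixed-fourthˡ false false false mix = ⊥-elim (mix (refl , refl))
Mixed-fourthˡ true  true  false mix (() , _)
Mixed-fourthˡ true  false true  mix (_ , ())
Mixed-fourthˡ true  false false mix (() , _)
Mixed-fourthˡ false true  true  mix (() , _)
Mixed-fourthˡ false true  false mix (_ , ())
Mixed-fourthˡ false false true  mix (() , _)

Mixed-fourthʳ : ∀ p q r → Mixed p q r → Mixed r q (fourth p q r)
Mixed-fourthʳ true  true  true  mix = ⊥-elim (mix (refl , refl))
Mixed-fourthʳ false false false mix = ⊥-elim (mix (refl , refl))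
Mixed-fourthʳ true  true  false mix (() , _)
Mixed-fourthʳ true  false true  mix (() , _)
Mixed-fourthʳ true  false false mix (_ , ())
Mixed-fourthʳ false true  true  mix (_ , ())
Mixed-fourthʳ false true  false mix (() , _)
Mixed-fourthʳ false false true  mix (() , _)

module _ {V : Set} {P : V → Set} {c : V → Bool} where

  mixed⇒lopsided : ∀ {x y z p q r} → x ≢ y → x ≢ z → y ≢ z →
    P x × c x ≡ p → P y × c y ≡ q → P z × c z ≡ r → Mixed p q r → Lopsided P c
  mixed⇒lopsided {p = true}  {true}  {true}  _ _ _ _ _ _ mix = ⊥-elim (mix (refl , refl))
  mixed⇒lopsided {p = false} {false} {false} _ _ _ _ _ _ mix = ⊥-elim (mix (refl , refl))
  mixed⇒lopsided {p = true}  {true}  {false} x≢y x≢z y≢z x y z _ = true  , (_ , _ , x≢y , x , y) , (_ , z)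
  mixed⇒lopsided {p = true}  {false} {true}  x≢y x≢z y≢z x y z _ = true  , (_ , _ , x≢z , x , z) , (_ , y)
  mixed⇒lopsided {p = true}  {false} {false} x≢y x≢z y≢z x y z _ = false , (_ , _ , y≢z , y , z) , (_ , x)
  mixed⇒lopsided {p = false} {true}  {true}  x≢y x≢z y≢z x y z _ = true  , (_ , _ , y≢z , y , z) , (_ , x)
  mixed⇒lopsided {p = false} {true}  {false} x≢y x≢z y≢z x y z _ = false , (_ , _ , x≢z , x , z) , (_ , y)
  mixed⇒lopsided {p = false} {false} {true}  x≢y x≢z y≢z x y z _ = false , (_ , _ , x≢y , x , y) , (_ , z)

  -- The two equal colours of a mixed triple cancel in the `xor`, so `z` repeats the minority
  -- colour.
  balanced : ∀ {w x y z p q r} → w ≢ x → w ≢ y → w ≢ z → x ≢ y → x ≢ z → y ≢ z →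
    P w × c w ≡ p → P x × c x ≡ q → P y × c y ≡ r → P z × c z ≡ fourth p q r →
    Mixed p q r → Full P c
  balanced {p = true}  {true}  {true}  _ _ _ _ _ _ _ _ _ _ mix = ⊥-elim (mix (refl , refl))
  balanced {p = false} {false} {false} _ _ _ _ _ _ _ _ _ _ mix = ⊥-elim (mix (refl , refl))
  balanced {p = true}  {true}  {false} w≢x w≢y w≢z x≢y x≢z y≢z w x y z _ =
    λ { true → _ , _ , w≢x , w , x ; false → _ , _ , y≢z , y , z }
  balanced {p = true}  {false} {true}  w≢x w≢y w≢z x≢y x≢z y≢z w x y z _ =
    λ { true → _ , _ , w≢y , w , y ; false → _ , _ , x≢z , x , z }
  balanced {p = true}  {false} {false} w≢x w≢y w≢z x≢y x≢z y≢z w x y z _ =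
    λ { true → _ , _ , w≢z , w , z ; false → _ , _ , x≢y , x , y }
  balanced {p = false} {true}  {true}  w≢x w≢y w≢z x≢y x≢z y≢z w x y z _ =
    λ { false → _ , _ , w≢z , w , z ; true → _ , _ , x≢y , x , y }
  balanced {p = false} {true}  {false} w≢x w≢y w≢z x≢y x≢z y≢z w x y z _ =
    λ { false → _ , _ , w≢y , w , y ; true → _ , _ , x≢z , x , z }
  balanced {p = false} {false} {true}  w≢x w≢y w≢z x≢y x≢z y≢z w x y z _ =
    λ { false → _ , _ , w≢x , w , x ; true → _ , _ , y≢z , y , z }

-- Triangulated polygons and the triangle on an edge.

-- A triangulated convex polygon whose vertices are the positions 0, …, m.
record Triangulation (m : ℕ) : Set₁ where
  field
    E           : ℕ → ℕ → Set
    E?          : ∀ i j → Dec (E i j)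
    E-sym       : ∀ {i j} → E i j → E j i
    E-irrefl    : ∀ {i} → ¬ E i i
    E-bounded   : ∀ {i j} → E i j → j ≤ m
    noncrossing : ∀ {a b c d} → E a c → E b d → a < b → b < c → c < d → ⊥
    maximal     : ∀ {i j} → i < j → j ≤ m → ¬ E i j →
                  ∃[ a ] ∃[ b ] E a b × i < a × a < j × (b < i ⊎ j < b)

  -- No position lies strictly between the two ends, so no edge can block this one.
  E-suc : ∀ {i} → suc i ≤ m → E i (suc i)
  E-suc {i} i<m with E? i (suc i)
  ... | yes e = e
  ... | no ¬e with maximal ℕ.≤-refl i<m ¬e
  ...   | _ , _ , _ , i<a , a<1+i , _ = contradiction (ℕ.≤-pred a<1+i) (ℕ.<⇒≱ i<a)

  -- A blocking edge would need an end outside `0, …, m`.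
  E-hull : 0 < m → E 0 m
  E-hull 0<m with E? 0 m
  ... | yes e = e
  ... | no ¬e with maximal 0<m ℕ.≤-refl ¬e
  ...   | _ , _ , ab , _ , _ , inj₂ m<b = contradiction (E-bounded ab) (ℕ.<⇒≱ m<b)

  -- Search downwards from `j - 1`; it stops at `suc i` at the latest, which `E-suc` makes a
  -- neighbour. The result is the candidate for the third corner of the triangle on `i j`.
  last-neighbour : ∀ {i j} → suc i < j → j ≤ m →
    ∃[ k ] i < k × k < j × E i k × (∀ {a} → k < a → a < j → ¬ E i a)
  last-neighbour {i} {suc j} (s≤s i<j) j<m with E? i j
  ... | yes e = j , i<j , ℕ.≤-refl , e , λ { j<a (s≤s a≤j) _ → ℕ.<⇒≱ j<a a≤j }
  ... | no ¬e with ℕ.m≤n⇒m<n∨m≡n i<j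
  ...   | inj₂ refl = contradiction (E-suc (ℕ.<⇒≤ j<m)) ¬e
  ...   | inj₁ 1+i<j with last-neighbour 1+i<j (ℕ.<⇒≤ j<m)
  ...     | k , i<k , k<j , e , none = k , i<k , ℕ.m≤n⇒m≤1+n k<j , e , none′
    where
    none′ : ∀ {a} → k < a → a < suc j → ¬ E i a
    none′ k<a (s≤s a≤j) with ℕ.m≤n⇒m<n∨m≡n a≤j
    ... | inj₁ a<j  = none k<a a<j
    ... | inj₂ refl = ¬e

  -- An edge crossing kj would have to cross ij or ik, unless it joins i to a
  -- neighbour beyond the last one.
  apex : ∀ {i j} → suc i < j → E i j → ∃[ k ] i < k × k < j × E i k × E k j
  apex {i} {j} 1+i<j ij with last-neighbour 1+i<j (E-bounded ij)
  ... | k , i<k , k<j , ik , none with E? k j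
  ...   | yes kj = k , i<k , k<j , ik , kj
  ...   | no ¬kj with maximal k<j (E-bounded ij) ¬kj
  ...     | a , b , ab , k<a , a<j , inj₂ j<b = ⊥-elim (noncrossing ij ab (ℕ.<-trans i<k k<a) a<j j<b)
  ...     | a , b , ab , k<a , a<j , inj₁ b<k with ℕ.<-cmp b i
  ...       | tri< b<i _ _  = ⊥-elim (noncrossing (E-sym ab) ij b<i (ℕ.<-trans i<k k<a) a<j)
  ...       | tri≈ _ refl _ = contradiction (E-sym ab) (none k<a a<j)
  ...       | tri> _ _ i<b  = ⊥-elim (noncrossing ik (E-sym ab) i<b b<k k<a)

  -- Ears: vertices lying in a single triangle.

  Ear : ℕ → Set
  Ear v = ∃[ x ] ∃[ y ] x ≢ y × E v x × E v y × (∀ {w} → E v w → w ≡ x ⊎ w ≡ y)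

  -- The side of the triangle opposite the tip separates the tip from all other vertices, so a
  -- further edge at the tip would cross it. As crossings are read in linear order, the tip is
  -- treated separately as middle, first and last position.
  ear-middle : ∀ {i} → E i (suc (suc i)) → E (suc i) (suc (suc i)) → E i (suc i) → Ear (suc i)
  ear-middle {i} ij kj ik = i , suc (suc i) , (λ ()) , E-sym ik , kj , only
    where
    only : ∀ {w} → E (suc i) w → w ≡ i ⊎ w ≡ suc (suc i)
    only {w} e with ℕ.<-cmp w i | ℕ.<-cmp w (suc (suc i))
    ... | tri< w<i _ _ | _             = ⊥-elim (noncrossing (E-sym e) ij w<i ℕ.≤-refl ℕ.≤-refl)
    ... | tri≈ _ w≡i _ | _             = inj₁ w≡i
    ... | tri> _ _ _   | tri≈ _ w≡j _  = inj₂ w≡j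
    ... | tri> _ _ _   | tri> _ _ j<w  = ⊥-elim (noncrossing ij e ℕ.≤-refl ℕ.≤-refl j<w)
    ... | tri> _ _ i<w | tri< (s≤s w≤k) _ _ with ℕ.≤-antisym w≤k i<w
    ...   | refl = ⊥-elim (E-irrefl e)

  ear-first : 1 < m → E 0 m → E 0 1 → E 1 m → Ear 0
  ear-first 1<m 0m e₀₁ 1m = 1 , m , ℕ.<⇒≢ 1<m , e₀₁ , 0m , only
    where
    only : ∀ {w} → E 0 w → w ≡ 1 ⊎ w ≡ m
    only {zero} e = ⊥-elim (E-irrefl e)
    only {suc zero} e = inj₁ refl
    only {suc (suc w)} e with ℕ.m≤n⇒m<n∨m≡n (E-bounded e)
    ... | inj₂ w≡m = inj₂ w≡m
    ... | inj₁ w<m = ⊥-elim (noncrossing e 1m (s≤s z≤n) (s≤s (s≤s z≤n)) w<m)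

  ear-last : ∀ {k} → suc k ≡ m → 0 < k → E 0 m → E 0 k → E k m → Ear m
  ear-last {k} refl 0<k 0m 0k km = 0 , k , ℕ.<⇒≢ 0<k , E-sym 0m , E-sym km , only
    where
    only : ∀ {w} → E (suc k) w → w ≡ 0 ⊎ w ≡ k
    only {zero} e = inj₁ refl
    only {suc w} e with ℕ.m≤n⇒m<n∨m≡n (E-bounded e)
    ... | inj₂ refl = ⊥-elim (E-irrefl e)
    ... | inj₁ (s≤s w<k) with ℕ.m≤n⇒m<n∨m≡n w<k
    ...   | inj₂ w≡k = inj₂ w≡k
    ...   | inj₁ w<k′ = ⊥-elim (noncrossing 0k (E-sym e) (s≤s z≤n) w<k′ ℕ.≤-refl)

  -- Colouring along the dual tree.

  -- Closed neighbours within [i , j]: a colouring of an interval says nothing outside it.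
  Near : ℕ → ℕ → ℕ → ℕ → Set
  Near i j v w = i ≤ w × w ≤ j × (w ≡ v ⊎ E v w)

  -- The exception refers to the whole polygon: `Ear` restricts all neighbours of `v`, not just
  -- those in the interval.
  Good : ℕ → ℕ → (ℕ → Bool) → ℕ → Set
  Good i j c v = Full (Near i j v) c ⊎ (Ear v × Lopsided (Near i j v) c)

  Good-extend : ∀ {i j i′ j′ c c′ v} → i′ ≤ i → j ≤ j′ →
    (∀ {w} → i ≤ w → w ≤ j → c′ w ≡ c w) → Good i j c v → Good i′ j′ c′ v
  Good-extend {i} {j} {i′} {j′} {c} {c′} {v} i′≤i j≤j′ agree = λ
    { (inj₁ full)      → inj₁ λ b → Two-lift id lift (full b)
    ; (inj₂ (ear , l)) → inj₂ (ear , Lopsided-lift id lift l) }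
    where
    lift : ∀ {w} → Near i j v w → ∃[ u ] u ≡ w × Near i′ j′ v u × c′ u ≡ c w
    lift (i≤w , w≤j , near) = _ , refl , (ℕ.≤-trans i′≤i i≤w , ℕ.≤-trans w≤j j≤j′ , near) , agree i≤w w≤j

  Apex : (ℕ → Bool) → ℕ → ℕ → Bool → ℕ → Set
  Apex c i j r k = i < k × k < j × E i k × E k j × c k ≡ r

  Roof : (ℕ → Bool) → ℕ → ℕ → Bool → Set
  Roof c i j r = suc i ≡ j ⊎ ∃[ k ] Apex c i j r k

  Roof-cong : ∀ {c c′ i j r} → (∀ {w} → i ≤ w → w ≤ j → c′ w ≡ c w) → Roof c i j r → Roof c′ i j r
  Roof-cong agree (inj₁ eq) = inj₁ eq
  Roof-cong agree (inj₂ (k , i<k , k<j , ik , kj , ck)) =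
    inj₂ (k , i<k , k<j , ik , kj , trans (agree (ℕ.<⇒≤ i<k) (ℕ.<⇒≤ k<j)) ck)

  -- The colours `p`, `q` of the ends and `r` of the apex are prescribed by the triangle on the
  -- other side of `i j`. The ends are left out of `interior` because they may have further
  -- neighbours outside the interval.
  record Coloured (i j : ℕ) (p q r : Bool) : Set where
    field
      colour   : ℕ → Bool
      left     : colour i ≡ p
      right    : colour j ≡ q
      interior : ∀ {v} → i < v → v < j → Good i j colour v
      -- Two levels of triangles are recorded, since the ends of the whole polygon are checked with
      -- the top triangle and a triangle next to it.
      roof     : suc i ≡ j ⊎ ∃[ k ] Apex colour i j r k ×
                 Roof colour i k (fourth p q r) × Roof colour k j (fourth p q r)

    topRoof : Roof colour i j r
    topRoof with roof
    ... | inj₁ eq = inj₁ eq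
    ... | inj₂ (k , a , _) = inj₂ (k , a)

  open Coloured

  single : ∀ {i p q r} → Coloured i (suc i) p q r
  single {i} {p} {q} = record
    { colour   = λ v → if does (v ≤? i) then p else q
    ; left     = cong (if_then p else q) (dec-true (i ≤? i) ℕ.≤-refl)
    ; right    = cong (if_then p else q) (dec-false (suc i ≤? i) ℕ.1+n≰n)
    ; interior = λ { i<v (s≤s v≤i) → contradiction v≤i (ℕ.<⇒≱ i<v) }
    ; roof     = inj₁ refl
    }

  -- The triangles beyond `i k` and `k j` receive `fourth p q r` at their apexes, so each makes two
  -- of each colour together with `i k j`. The only new interior vertex is `k`.
  glue : ∀ {i k j p q r} → i < k → k < j → E i k → E k j → E i j → Mixed p q r →
    Coloured i k p r (fourth p q r) → Coloured k j r q (fourth p q r) → Coloured i j p q r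
  glue {i} {k} {j} {p} {q} {r} i<k k<j ik kj ij mix L R = record
    { colour   = c
    ; left     = ci
    ; right    = cj
    ; interior = good-inside
    ; roof     = inj₂ (k , (i<k , k<j , ik , kj , ck) ,
                       Roof-cong (λ _ → agreeˡ) (topRoof L) , Roof-cong (λ k≤w _ → agreeʳ k≤w) (topRoof R))
    }
    where
    c : ℕ → Bool
    c v = if does (v ≤? k) then colour L v else colour R v

    agreeˡ : ∀ {w} → w ≤ k → c w ≡ colour L w
    agreeˡ {w} w≤k = cong (if_then colour L w else colour R w) (dec-true (w ≤? k) w≤k)

    agreeʳ : ∀ {w} → k ≤ w → c w ≡ colour R w
    agreeʳ {w} k≤w with ℕ.m≤n⇒m<n∨m≡n k≤w
    ... | inj₁ k<w  = cong (if_then colour L w else colour R w) (dec-false (w ≤? k) (ℕ.<⇒≱ k<w))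
    -- At the seam both halves give `k` the colour `r`.
    ... | inj₂ refl = trans (agreeˡ ℕ.≤-refl) (trans (right L) (sym (left R)))

    ci : c i ≡ p
    ci = trans (agreeˡ (ℕ.<⇒≤ i<k)) (left L)

    cj : c j ≡ q
    cj = trans (agreeʳ (ℕ.<⇒≤ k<j)) (right R)

    ck : c k ≡ r
    ck = trans (agreeˡ ℕ.≤-refl) (right L)

    i<j : i < j
    i<j = ℕ.<-trans i<k k<j

    nearI : Near i j k i
    nearI = ℕ.≤-refl , ℕ.<⇒≤ i<j , inj₂ (E-sym ik)

    nearJ : Near i j k j
    nearJ = ℕ.<⇒≤ i<j , ℕ.≤-refl , inj₂ kj

    nearK : Near i j k k
    nearK = ℕ.<⇒≤ i<k , ℕ.<⇒≤ k<j , inj₁ refl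

    -- One further triangle on `i k` or `k j` already shows `k` both colours twice. If there is
    -- none, both are sides of the polygon and `k` is an ear.
    goodApex : Good i j c k
    goodApex with topRoof L | topRoof R
    ... | inj₂ (l , i<l , l<k , il , lk , cl) | _ =
      inj₁ (balanced (ℕ.<⇒≢ i<j) (ℕ.<⇒≢ i<k) (ℕ.<⇒≢ i<l) (ℕ.>⇒≢ k<j)
        (ℕ.>⇒≢ (ℕ.<-trans l<k k<j)) (ℕ.>⇒≢ l<k)
        (nearI , ci) (nearJ , cj) (nearK , ck)
        ((ℕ.<⇒≤ i<l , ℕ.<⇒≤ (ℕ.<-trans l<k k<j) , inj₂ (E-sym lk)) , trans (agreeˡ (ℕ.<⇒≤ l<k)) cl) mix)
    ... | inj₁ _ | inj₂ (l , k<l , l<j , kl , lj , cl) =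
      inj₁ (balanced (ℕ.<⇒≢ i<j) (ℕ.<⇒≢ i<k) (ℕ.<⇒≢ (ℕ.<-trans i<k k<l)) (ℕ.>⇒≢ k<j)
        (ℕ.>⇒≢ l<j) (ℕ.<⇒≢ k<l)
        (nearI , ci) (nearJ , cj) (nearK , ck)
        ((ℕ.<⇒≤ (ℕ.<-trans i<k k<l) , ℕ.<⇒≤ l<j , inj₂ kl) , trans (agreeʳ (ℕ.<⇒≤ k<l)) cl) mix)
    ... | inj₁ refl | inj₁ refl =
      inj₂ (ear-middle ij kj ik , mixed⇒lopsided (ℕ.<⇒≢ i<j) (ℕ.<⇒≢ i<k) (ℕ.>⇒≢ k<j)
        (nearI , ci) (nearJ , cj) (nearK , ck) mix)

    good-inside : ∀ {v} → i < v → v < j → Good i j c v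
    good-inside {v} i<v v<j with ℕ.<-cmp v k
    ... | tri< v<k _ _  = Good-extend ℕ.≤-refl (ℕ.<⇒≤ k<j) (λ _ → agreeˡ) (interior L i<v v<k)
    ... | tri≈ _ refl _ = goodApex
    ... | tri> _ _ k<v  = Good-extend (ℕ.<⇒≤ i<k) ℕ.≤-refl (λ k≤w _ → agreeʳ k≤w) (interior R k<v v<j)

  -- s is fuel for recursion on the length of the interval.
  colour-interval : ∀ s {i j p q r} → j ≤ s + i → i < j → E i j → Mixed p q r → Coloured i j p q r
  colour-interval zero j≤i i<j _ _ = contradiction j≤i (ℕ.<⇒≱ i<j)
  colour-interval (suc s) {i} {j} {p} {q} {r} j≤1+s+i i<j ij mix with ℕ.m≤n⇒m<n∨m≡n i<j
  ... | inj₂ refl = single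
  ... | inj₁ 1+i<j with apex 1+i<j ij
  ...   | k , i<k , k<j , ik , kj = glue i<k k<j ik kj ij mix
    (colour-interval s (ℕ.≤-pred (ℕ.≤-trans k<j j≤1+s+i)) i<k ik (Mixed-fourthˡ p q r mix))
    (colour-interval s j≤s+k k<j kj (Mixed-fourthʳ p q r mix))
    where
    j≤s+k : j ≤ s + k
    j≤s+k = ℕ.≤-trans j≤1+s+i (ℕ.≤-trans (ℕ.≤-reflexive (sym (ℕ.+-suc s i))) (ℕ.+-monoʳ-≤ s i<k))

  -- The edge `0 m` roots the dual tree, with the whole polygon as its interval; only the ends `0`
  -- and `m` remain to be checked.
  good-colouring : 1 < m → ∃[ c ] (∀ {v} → v ≤ m → Good 0 m c v)
  good-colouring 1<m = c , good
    where
    0<m : 0 < m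
    0<m = ℕ.<⇒≤ 1<m

    0m : E 0 m
    0m = E-hull 0<m

    -- The root triangle may have any mixed colours; here the ends `0` and `m` already differ.
    mix : Mixed true false true
    mix (() , _)

    C : Coloured 0 m true false true
    C = colour-interval m (ℕ.≤-reflexive (sym (ℕ.+-identityʳ m))) 0<m 0m mix

    c : ℕ → Bool
    c = colour C

    -- Besides the root triangle, `0` lies in the one on `0 k`, unless `0 k` is a side and `0` an
    -- ear. The last vertex is treated in the same way with `k m`.
    goodFirst : Good 0 m c 0
    goodFirst with roof C
    ... | inj₁ 1≡m = contradiction 1≡m (ℕ.<⇒≢ 1<m)
    ... | inj₂ (k , (0<k , k<m , 0k , km , ck) , inj₂ (l , 0<l , l<k , 0l , lk , cl) , _) =
      inj₁ (balanced (ℕ.<⇒≢ 0<m) (ℕ.<⇒≢ 0<k) (ℕ.<⇒≢ 0<l) (ℕ.>⇒≢ k<m)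
        (ℕ.>⇒≢ (ℕ.<-trans l<k k<m)) (ℕ.>⇒≢ l<k)
        ((z≤n , z≤n , inj₁ refl) , left C) ((z≤n , ℕ.≤-refl , inj₂ 0m) , right C)
        ((z≤n , ℕ.<⇒≤ k<m , inj₂ 0k) , ck)
        ((z≤n , ℕ.<⇒≤ (ℕ.<-trans l<k k<m) , inj₂ 0l) , cl) mix)
    ... | inj₂ (k , (0<k , k<m , 0k , km , ck) , inj₁ refl , _) =
      inj₂ (ear-first 1<m 0m 0k km , mixed⇒lopsided (ℕ.<⇒≢ 0<m) (ℕ.<⇒≢ 0<k) (ℕ.>⇒≢ k<m)
        ((z≤n , z≤n , inj₁ refl) , left C) ((z≤n , ℕ.≤-refl , inj₂ 0m) , right C)
        ((z≤n , ℕ.<⇒≤ k<m , inj₂ 0k) , ck) mix)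

    goodLast : Good 0 m c m
    goodLast with roof C
    ... | inj₁ 1≡m = contradiction 1≡m (ℕ.<⇒≢ 1<m)
    ... | inj₂ (k , (0<k , k<m , 0k , km , ck) , _ , inj₂ (l , k<l , l<m , kl , lm , cl)) =
      inj₁ (balanced (ℕ.<⇒≢ 0<m) (ℕ.<⇒≢ 0<k) (ℕ.<⇒≢ (ℕ.<-trans 0<k k<l)) (ℕ.>⇒≢ k<m)
        (ℕ.>⇒≢ l<m) (ℕ.<⇒≢ k<l)
        ((z≤n , z≤n , inj₂ (E-sym 0m)) , left C) ((z≤n , ℕ.≤-refl , inj₁ refl) , right C)
        ((z≤n , ℕ.<⇒≤ k<m , inj₂ (E-sym km)) , ck)
        ((z≤n , ℕ.<⇒≤ l<m , inj₂ (E-sym lm)) , cl) mix)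
    ... | inj₂ (k , (0<k , k<m , 0k , km , ck) , _ , inj₁ 1+k≡m) =
      inj₂ (ear-last 1+k≡m 0<k 0m 0k km , mixed⇒lopsided (ℕ.<⇒≢ 0<m) (ℕ.<⇒≢ 0<k) (ℕ.>⇒≢ k<m)
        ((z≤n , z≤n , inj₂ (E-sym 0m)) , left C) ((z≤n , ℕ.≤-refl , inj₁ refl) , right C)
        ((z≤n , ℕ.<⇒≤ k<m , inj₂ (E-sym km)) , ck) mix)

    good : ∀ {v} → v ≤ m → Good 0 m c v
    good {zero} _ = goodFirst
    good {suc v} v≤m with ℕ.m≤n⇒m<n∨m≡n v≤m
    ... | inj₁ v<m  = interior C (s≤s z≤n) v<m
    ... | inj₂ refl = goodLast

-- Sizes of finite subsets.

module _ {n : ℕ} {P : U.Pred (Fin n) 0ℓ} (P? : U.Decidable P) where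

  ∈-subsetOf⁺ : ∀ {v} → P v → v ∈ subsetOf P?
  ∈-subsetOf⁺ {v} pv = lookup⇒[]= v _ (trans (lookup∘tabulate _ v) (dec-true (P? v) pv))

  ∈-subsetOf⁻ : ∀ {v} → v ∈ subsetOf P? → P v
  ∈-subsetOf⁻ {v} v∈ with P? v | trans (sym (lookup∘tabulate (does ∘ P?) v)) ([]=⇒lookup v∈)
  ... | yes pv | _ = pv
  ... | no _   | ()

∣p∪q∣≤∣p∣+∣q∣ : ∀ {n} (p q : Subset n) → ∣ p ∪ q ∣ ≤ ∣ p ∣ + ∣ q ∣
∣p∪q∣≤∣p∣+∣q∣ []            []            = z≤n
∣p∪q∣≤∣p∣+∣q∣ (outside ∷ p) (outside ∷ q) = ∣p∪q∣≤∣p∣+∣q∣ p q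
∣p∪q∣≤∣p∣+∣q∣ (outside ∷ p) (inside  ∷ q) =
  ℕ.≤-trans (s≤s (∣p∪q∣≤∣p∣+∣q∣ p q)) (ℕ.≤-reflexive (sym (ℕ.+-suc ∣ p ∣ ∣ q ∣)))
∣p∪q∣≤∣p∣+∣q∣ (inside  ∷ p) (outside ∷ q) = s≤s (∣p∪q∣≤∣p∣+∣q∣ p q)
∣p∪q∣≤∣p∣+∣q∣ (inside  ∷ p) (inside  ∷ q) =
  s≤s (ℕ.≤-trans (∣p∪q∣≤∣p∣+∣q∣ p q) (ℕ.+-monoʳ-≤ ∣ p ∣ (ℕ.n≤1+n ∣ q ∣)))

∣p∣+∣q∣≤∣r∣ : ∀ {n} (p q r : Subset n) → p ⊆ r → q ⊆ r → (∀ {v} → v ∈ p → v ∉ q) → ∣ p ∣ + ∣ q ∣ ≤ ∣ r ∣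
∣p∣+∣q∣≤∣r∣ []      []      []      _   _   _   = z≤n
∣p∣+∣q∣≤∣r∣ (x ∷ p) (y ∷ q) (z ∷ r) p⊆r q⊆r p∩q = go x y z p⊆r q⊆r p∩q
  where
  tails : ∣ p ∣ + ∣ q ∣ ≤ ∣ r ∣
  tails = ∣p∣+∣q∣≤∣r∣ p q r (drop-∷-⊆ p⊆r) (drop-∷-⊆ q⊆r) (λ v∈p v∈q → p∩q (there v∈p) (there v∈q))

  go : ∀ x y z → x ∷ p ⊆ z ∷ r → y ∷ q ⊆ z ∷ r → (∀ {v} → v ∈ x ∷ p → v ∉ y ∷ q) →
       ∣ x ∷ p ∣ + ∣ y ∷ q ∣ ≤ ∣ z ∷ r ∣
  go inside  inside  _       _   _   dis = ⊥-elim (dis here here)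
  go inside  _       outside p⊆r _   _   with p⊆r here
  ... | ()
  go _       inside  outside _   q⊆r _   with q⊆r here
  ... | ()
  go inside  outside inside  _   _   _   = s≤s tails
  go outside inside  inside  _   _   _   = subst (_≤ suc ∣ r ∣) (sym (ℕ.+-suc ∣ p ∣ ∣ q ∣)) (s≤s tails)
  go outside outside z       _   _   _   = ℕ.≤-trans tails (∣p∣≤∣x∷p∣ z r)

image : ∀ {m n} → (Fin m → Fin n) → Subset m → Subset n
image f []            = Subset.⊥
image f (inside  ∷ p) = ⁅ f Fin.zero ⁆ ∪ image (f ∘ Fin.suc) p
image f (outside ∷ p) = image (f ∘ Fin.suc) p

∈-image : ∀ {m n} (f : Fin m → Fin n) {p v} → v ∈ p → f v ∈ image f p
∈-image f {inside  ∷ p} here        = p⊆p∪q _ (x∈⁅x⁆ _)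
∈-image f {inside  ∷ p} (there v∈p) = q⊆p∪q ⁅ f Fin.zero ⁆ _ (∈-image (f ∘ Fin.suc) v∈p)
∈-image f {outside ∷ p} (there v∈p) = ∈-image (f ∘ Fin.suc) v∈p

-- Only an inequality, as `f` may merge elements: one vertex may repair several ears.
∣image∣≤ : ∀ {m n} (f : Fin m → Fin n) p → ∣ image f p ∣ ≤ ∣ p ∣
∣image∣≤ {n = n} f []  = ℕ.≤-reflexive (∣⊥∣≡0 n)
∣image∣≤ f (inside  ∷ p) = ℕ.≤-trans (∣p∪q∣≤∣p∣+∣q∣ ⁅ f Fin.zero ⁆ _)
  (ℕ.+-mono-≤ (ℕ.≤-reflexive (∣⁅x⁆∣≡1 (f Fin.zero))) (∣image∣≤ (f ∘ Fin.suc) p))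
∣image∣≤ f (outside ∷ p) = ∣image∣≤ (f ∘ Fin.suc) p

2≤∣p∣ : ∀ {n} {p : Subset n} {x y} → x ≢ y → x ∈ p → y ∈ p → 2 ≤ ∣ p ∣
2≤∣p∣ {p = p} {x} {y} x≢y x∈p y∈p =
  ℕ.≤-trans (s≤s (ℕ.≤-trans (s≤s z≤n) (x∈p⇒∣p-x∣<∣p∣ (x∈p∧x≢y⇒x∈p-y x∈p x≢y)))) (x∈p⇒∣p-x∣<∣p∣ y∈p)

∣p∣≡2 : ∀ {n} {p : Subset n} {x y} → x ≢ y → x ∈ p → y ∈ p → (∀ {w} → w ∈ p → w ≡ x ⊎ w ≡ y) → ∣ p ∣ ≡ 2
∣p∣≡2 {p = p} {x} {y} x≢y x∈p y∈p only = ℕ.≤-antisym ∣p∣≤2 (2≤∣p∣ x≢y x∈p y∈p)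
  where
  p⊆ : p ⊆ ⁅ x ⁆ ∪ ⁅ y ⁆
  p⊆ w∈p with only w∈p
  ... | inj₁ refl = p⊆p∪q _ (x∈⁅x⁆ x)
  ... | inj₂ refl = q⊆p∪q ⁅ x ⁆ _ (x∈⁅x⁆ y)

  ∣p∣≤2 : ∣ p ∣ ≤ 2
  ∣p∣≤2 = ℕ.≤-trans (p⊆q⇒∣p∣≤∣q∣ p⊆) (ℕ.≤-trans (∣p∪q∣≤∣p∣+∣q∣ ⁅ x ⁆ ⁅ y ⁆)
    (ℕ.≤-reflexive (trans (cong (_+ ∣ ⁅ y ⁆ ∣) (∣⁅x⁆∣≡1 x)) (cong suc (∣⁅x⁆∣≡1 y)))))

-- Twice the smaller summand is at most `s`. This selects the repaired class that meets the bound.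
halve : ∀ a b {s} → a + b ≤ s → a ≤ ⌊ s /2⌋ ⊎ b ≤ ⌊ s /2⌋
halve a b a+b≤s with ℕ.≤-total a b
... | inj₁ a≤b = inj₁ (subst (_≤ _) (sym (ℕ.n≡⌊n+n/2⌋ a)) (ℕ.⌊n/2⌋-mono (ℕ.≤-trans (ℕ.+-monoʳ-≤ a a≤b) a+b≤s)))
... | inj₂ b≤a = inj₂ (subst (_≤ _) (sym (ℕ.n≡⌊n+n/2⌋ b)) (ℕ.⌊n/2⌋-mono (ℕ.≤-trans (ℕ.+-monoˡ-≤ b b≤a) a+b≤s)))

-- Double dominating sets from a colouring.

module _ {n : ℕ} (G : Graph n) where

  doubleDominating? : U.Decidable (DoubleDominating G)
  doubleDominating? S = Fin.all? (λ v → 2 ≤? ∣ N[ G ] v ∩ S ∣)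

  -- The double domination number is a relation, so a minimum must be exhibited: pass to a smaller
  -- double dominating set as long as one exists, with `k` bounding the number of rounds.
  minimise : ∀ k S → ∣ S ∣ ≤ k → DoubleDominating G S → ∃[ γ ] IsDoubleDominationNumber G γ × γ ≤ ∣ S ∣
  minimise k S ∣S∣≤k dd with anySubset? (λ T → doubleDominating? T ×-dec (suc ∣ T ∣ ≤? ∣ S ∣))
  ... | no none = ∣ S ∣ , ((S , dd , refl) , λ T ddT → ℕ.≮⇒≥ (λ T<S → none (T , ddT , T<S))) , ℕ.≤-refl
  minimise zero    S ∣S∣≤0 dd | yes (T , ddT , T<S) = contradiction (ℕ.≤-trans T<S ∣S∣≤0) λ ()
  minimise (suc k) S ∣S∣≤k dd | yes (T , ddT , T<S)
    with minimise k T (ℕ.≤-pred (ℕ.≤-trans T<S ∣S∣≤k)) ddT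
  ... | γ , isγ , γ≤T = γ , isγ , ℕ.≤-trans γ≤T (ℕ.<⇒≤ T<S)

  ClosedNbr : Fin n → Fin n → Set
  ClosedNbr v u = u ≡ v ⊎ Adj G v u

  Covered : (Fin n → Bool) → Fin n → Set
  Covered c v = Full (ClosedNbr v) c ⊎ (degree G v ≡ 2 × Lopsided (ClosedNbr v) c)

  -- Each colour class is repaired at the degree-2 vertices that see its colour
  -- only once, by adding a closed neighbour of the other colour.
  module Repair (c : Fin n → Bool) (cov : ∀ v → Covered c v) where

    -- Read off from the certificate rather than by counting: `b′` is the colour it shows twice.
    Lacks : ∀ {v} → Bool → Covered c v → Set
    Lacks b (inj₁ _)             = ⊥
    Lacks b (inj₂ (_ , b′ , _)) = b ≡ not b′

    lacks? : ∀ {v} b (x : Covered c v) → Dec (Lacks b x)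
    lacks? b (inj₁ _)             = no λ ()
    lacks? b (inj₂ (_ , b′ , _)) = b Bool.≟ not b′

    repair : ∀ {v} → Covered c v → Fin n
    -- A placeholder: such a vertex lacks no colour, so this value never enters a repaired class.
    repair {v} (inj₁ _)                        = v
    repair {v} (inj₂ (_ , _ , (x , _) , _)) = x

    Class Lack : Bool → Subset n
    Class b = subsetOf (λ v → c v Bool.≟ b)
    Lack  b = subsetOf (λ v → lacks? b (cov v))

    Repaired : Bool → Subset n
    Repaired b = Class b ∪ image (repair ∘ cov) (Lack b)

    in-class : ∀ {b x} → c x ≡ b → x ∈ Repaired b
    in-class {b} cx = p⊆p∪q _ (∈-subsetOf⁺ (λ v → c v Bool.≟ b) cx)

    in-repair : ∀ {b v} → Lacks b (cov v) → repair (cov v) ∈ Repaired b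
    in-repair {b} l = q⊆p∪q (Class b) _ (∈-image (repair ∘ cov) (∈-subsetOf⁺ (λ v → lacks? b (cov v)) l))

    dominated : ∀ {b v x y} → x ≢ y → ClosedNbr v x → ClosedNbr v y →
      x ∈ Repaired b → y ∈ Repaired b → 2 ≤ ∣ N[ G ] v ∩ Repaired b ∣
    dominated {b} {v} x≢y nx ny x∈ y∈ = 2≤∣p∣ x≢y
      (x∈p∩q⁺ (∈-subsetOf⁺ nbr? nx , x∈)) (x∈p∩q⁺ (∈-subsetOf⁺ nbr? ny , y∈))
      where
      nbr? : U.Decidable (ClosedNbr v)
      nbr? u = (u Fin.≟ v) ⊎-dec adj? G v u

    dominated-two : ∀ {b v} → Two (ClosedNbr v) c b → 2 ≤ ∣ N[ G ] v ∩ Repaired b ∣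
    dominated-two (x , y , x≢y , (nx , cx) , (ny , cy)) = dominated x≢y nx ny (in-class cx) (in-class cy)

    Repaired-dominating : ∀ b → DoubleDominating G (Repaired b)
    Repaired-dominating b v with cov v | in-repair {b} {v}
    ... | inj₁ full | _ = dominated-two (full b)
    ... | inj₂ (_ , b′ , two@(x , _ , _ , (nx , cx) , _) , (z , nz , cz)) | rep with b Bool.≟ b′
    ...   | yes refl = dominated-two two
    -- The neighbourhood shows `b` once, at `z`; the repair vertex `x` has colour `b′` and is
    -- therefore a second, different vertex.
    ...   | no b≢b′ = dominated x≢z nx nz (rep b≡) (in-class (trans cz (sym b≡)))
      where
      b≡ : b ≡ not b′
      b≡ = Bool.¬-not b≢b′

      x≢z : x ≢ z
      x≢z refl = Bool.not-¬ cx cz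

    ∣Class∣ : ∣ Class true ∣ + ∣ Class false ∣ ≤ n
    ∣Class∣ = subst (∣ Class true ∣ + ∣ Class false ∣ ≤_) (∣⊤∣≡n n)
      (∣p∣+∣q∣≤∣r∣ _ _ ⊤ (λ _ → ∈⊤) (λ _ → ∈⊤) disjoint)
      where
      disjoint : ∀ {v} → v ∈ Class true → v ∉ Class false
      disjoint v∈t v∈f with trans (sym (∈-subsetOf⁻ (λ v → c v Bool.≟ true) v∈t)) (∈-subsetOf⁻ (λ v → c v Bool.≟ false) v∈f)
      ... | ()

    -- Only degree-2 vertices lack a colour, and each lacks the single colour `not b′`, so none is
    -- counted twice.
    ∣Lack∣ : ∣ Lack true ∣ + ∣ Lack false ∣ ≤ #degree2 G
    ∣Lack∣ = ∣p∣+∣q∣≤∣r∣ _ _ _ (degree2 true) (degree2 false) disjoint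
      where
      degree2 : ∀ b {v} → v ∈ Lack b → v ∈ subsetOf (λ v → degree G v Nat.≟ 2)
      degree2 b {v} v∈ with cov v | ∈-subsetOf⁻ (λ v → lacks? b (cov v)) v∈
      ... | inj₂ (d , _) | _ = ∈-subsetOf⁺ (λ v → degree G v Nat.≟ 2) d

      disjoint : ∀ {v} → v ∈ Lack true → v ∉ Lack false
      disjoint {v} v∈t v∈f
        with cov v | ∈-subsetOf⁻ (λ v → lacks? true (cov v)) v∈t | ∈-subsetOf⁻ (λ v → lacks? false (cov v)) v∈f
      ... | inj₂ _ | t≡ | f≡ with trans t≡ (sym f≡)
      ...   | ()

    ∣Repaired∣≤ : ∀ b → ∣ Repaired b ∣ ≤ ∣ Class b ∣ + ∣ Lack b ∣
    ∣Repaired∣≤ b = ℕ.≤-trans (∣p∪q∣≤∣p∣+∣q∣ (Class b) _) (ℕ.+-monoʳ-≤ ∣ Class b ∣ (∣image∣≤ (repair ∘ cov) (Lack b)))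

    ∣Repaired∣-sum : ∣ Repaired true ∣ + ∣ Repaired false ∣ ≤ n + #degree2 G
    ∣Repaired∣-sum = begin
      ∣ Repaired true ∣ + ∣ Repaired false ∣
        ≤⟨ ℕ.+-mono-≤ (∣Repaired∣≤ true) (∣Repaired∣≤ false) ⟩
      (∣ Class true ∣ + ∣ Lack true ∣) + (∣ Class false ∣ + ∣ Lack false ∣)
        ≡⟨ interchange (∣ Class true ∣) (∣ Lack true ∣) (∣ Class false ∣) (∣ Lack false ∣) ⟩
      (∣ Class true ∣ + ∣ Class false ∣) + (∣ Lack true ∣ + ∣ Lack false ∣)
        ≤⟨ ℕ.+-mono-≤ ∣Class∣ ∣Lack∣ ⟩
      n + #degree2 G ∎
      where open ℕ.≤-Reasoning

    γ×₂≤half : ∃[ γ ] IsDoubleDominationNumber G γ × γ ≤ ⌊ n + #degree2 G /2⌋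
    γ×₂≤half with halve (∣ Repaired true ∣) (∣ Repaired false ∣) ∣Repaired∣-sum
    ... | inj₁ ≤half with minimise _ (Repaired true) ℕ.≤-refl (Repaired-dominating true)
    ...   | γ , isγ , γ≤ = γ , isγ , ℕ.≤-trans γ≤ ≤half
    γ×₂≤half | inj₂ ≤half with minimise _ (Repaired false) ℕ.≤-refl (Repaired-dominating false)
    ...   | γ , isγ , γ≤ = γ , isγ , ℕ.≤-trans γ≤ ≤half

-- From a maximal outerplanar graph to a triangulated polygon.

module Positions {m : ℕ} (G : Graph (suc m)) (π : Permutation′ (suc m)) where

  pos : Fin (suc m) → ℕ
  pos v = toℕ (π ⟨$⟩ʳ v)

  pos-injective : ∀ {u v} → pos u ≡ pos v → u ≡ v
  pos-injective = Injection.injective (↔⇒↣ π) ∘ Fin.toℕ-injective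

  pos≤m : ∀ v → pos v ≤ m
  pos≤m v = ℕ.≤-pred (Fin.toℕ<n (π ⟨$⟩ʳ v))

  -- Quantifying over vertices leaves positions beyond `m` without edges.
  EdgeAt : ℕ → ℕ → Set
  EdgeAt i j = ∃[ u ] ∃[ v ] pos u ≡ i × pos v ≡ j × Adj G u v

  edgeAt? : ∀ i j → Dec (EdgeAt i j)
  edgeAt? i j = Fin.any? λ u → Fin.any? λ v → (pos u Nat.≟ i) ×-dec ((pos v Nat.≟ j) ×-dec adj? G u v)

  Crossing : Fin (suc m) → Fin (suc m) → Set
  Crossing u v = ∃[ a ] ∃[ b ] Adj G a b × pos u < pos a × pos a < pos v × (pos b < pos u ⊎ pos v < pos b)

  crossing? : ∀ u v → Dec (Crossing u v)
  crossing? u v = Fin.any? λ a → Fin.any? λ b → adj? G a b ×-dec ((pos u Nat.<? pos a) ×-dec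
    ((pos a Nat.<? pos v) ×-dec ((pos b Nat.<? pos u) ⊎-dec (pos v Nat.<? pos b))))

  -- If exactly one of two alternating edges is the new one, the other is a `Crossing`, with inner
  -- end `b` or `c`. Reading the new edge from `v` to `u` contradicts the order, and it cannot
  -- alternate with itself.
  addEdge-noncrossing : ∀ {u v} (u≢v : u ≢ v) → pos u < pos v → ¬ Crossing u v →
    NonCrossing G π → NonCrossing (addEdge G u v u≢v) π
  addEdge-noncrossing u≢v u<v none nc (inj₁ ac) (inj₁ bd) = nc ac bd
  addEdge-noncrossing u≢v u<v none nc (inj₂ (inj₁ (refl , refl))) (inj₁ bd) (a<b , b<c , c<d) =
    none (_ , _ , bd , a<b , b<c , inj₂ c<d)
  addEdge-noncrossing u≢v u<v none nc (inj₂ (inj₂ (refl , refl))) _ (a<b , b<c , _) =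
    ℕ.<-asym u<v (ℕ.<-trans a<b b<c)
  addEdge-noncrossing u≢v u<v none nc (inj₁ ac) (inj₂ (inj₁ (refl , refl))) (a<b , b<c , c<d) =
    none (_ , _ , adj-sym G ac , b<c , c<d , inj₁ a<b)
  addEdge-noncrossing u≢v u<v none nc _ (inj₂ (inj₂ (refl , refl))) (_ , b<c , c<d) =
    ℕ.<-asym u<v (ℕ.<-trans b<c c<d)
  addEdge-noncrossing u≢v u<v none nc (inj₂ (inj₁ (refl , refl))) (inj₂ (inj₁ (refl , refl))) (a<b , _) =
    ℕ.<-irrefl refl a<b

  vertexAt : ∀ {i} → i ≤ m → ∃[ v ] pos v ≡ i
  vertexAt {i} i≤m = π ⟨$⟩ˡ Fin.fromℕ< (s≤s i≤m) , trans (cong toℕ (inverseʳ π)) (Fin.toℕ-fromℕ< (s≤s i≤m))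

  triangulation : NonCrossing G π →
    (∀ u v (u≢v : u ≢ v) → ¬ Adj G u v → ¬ Outerplanar (addEdge G u v u≢v)) → Triangulation m
  triangulation nc max = record
    { E           = EdgeAt
    ; E?          = edgeAt?
    ; E-sym       = λ { (u , v , pu , pv , uv) → v , u , pv , pu , adj-sym G uv }
    ; E-irrefl    = irrefl
    ; E-bounded   = λ { (_ , v , _ , refl , _) → pos≤m v }
    ; noncrossing = λ { (_ , _ , refl , refl , ac) (_ , _ , refl , refl , bd) a<b b<c c<d → nc ac bd (a<b , b<c , c<d) }
    ; maximal     = maximal
    }
    where
    irrefl : ∀ {i} → ¬ EdgeAt i i
    irrefl (u , v , pu , pv , uv) with pos-injective (trans pu (sym pv))
    ... | refl = adj-irrefl G uv

    -- If no edge crossed the missing chord, adding it would keep the same arrangement `π`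
    -- noncrossing, against maximality. Finiteness decides whether a crossing edge exists and so
    -- supplies it.
    maximal : ∀ {i j} → i < j → j ≤ m → ¬ EdgeAt i j →
      ∃[ a ] ∃[ b ] EdgeAt a b × i < a × a < j × (b < i ⊎ j < b)
    maximal i<j j≤m ¬ij with vertexAt (ℕ.≤-trans (ℕ.<⇒≤ i<j) j≤m) | vertexAt j≤m
    ... | u , refl | v , refl with crossing? u v
    ...   | yes (a , b , ab , u<a , a<v , out) = pos a , pos b , (a , b , refl , refl , ab) , u<a , a<v , out
    ...   | no none = ⊥-elim (max u v u≢v (λ uv → ¬ij (u , v , refl , refl , uv))
                        (π , λ {_} {_} {_} {_} → addEdge-noncrossing u≢v i<j none nc))
      where
      u≢v : u ≢ v
      u≢v refl = ℕ.<-irrefl refl i<j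

  module _ (nc : NonCrossing G π)
           (max : ∀ u v (u≢v : u ≢ v) → ¬ Adj G u v → ¬ Outerplanar (addEdge G u v u≢v)) where

    open Triangulation (triangulation nc max)

    -- The vertex witnessing the first end sits at the position of `v`, hence is `v` by injectivity.
    neighbourAt : ∀ {v j} → EdgeAt (pos v) j → ∃[ w ] pos w ≡ j × Adj G v w
    neighbourAt (u , w , pu , pw , uw) with pos-injective pu
    ... | refl = w , pw , uw

    Ear⇒degree2 : ∀ {v} → Ear (pos v) → degree G v ≡ 2
    Ear⇒degree2 {v} (_ , _ , x≢y , vx , vy , only) with neighbourAt vx | neighbourAt vy
    ... | x , refl , ax | y , refl , ay =
      ∣p∣≡2 (λ { refl → x≢y refl }) (∈-subsetOf⁺ (adj? G v) ax) (∈-subsetOf⁺ (adj? G v) ay) only′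
      where
      only′ : ∀ {w} → w ∈ N⟨ G ⟩ v → w ≡ x ⊎ w ≡ y
      only′ {w} w∈ with only (v , w , refl , refl , ∈-subsetOf⁻ (adj? G v) w∈)
      ... | inj₁ w≡x = inj₁ (pos-injective w≡x)
      ... | inj₂ w≡y = inj₂ (pos-injective w≡y)

    Good⇒Covered : ∀ {c v} → Good 0 m c (pos v) → Covered G (c ∘ pos) v
    Good⇒Covered {c} {v} = λ
      { (inj₁ full)      → inj₁ λ b → Two-lift pos lift (full b)
      ; (inj₂ (ear , l)) → inj₂ (Ear⇒degree2 ear , Lopsided-lift pos lift l) }
      where
      lift : ∀ {x} → Near 0 m (pos v) x → ∃[ w ] pos w ≡ x × ClosedNbr G v w × c (pos w) ≡ c x
      lift (_ , _ , inj₁ refl) = v , refl , inj₁ refl , refl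
      lift (_ , _ , inj₂ vx) with neighbourAt vx
      ... | w , refl , vw = w , refl , inj₂ vw , refl

theorem3p5 : (n : ℕ) → 3 ≤ n → (G : Graph n) → MaximalOuterplanar G →
    ∃[ γ ] IsDoubleDominationNumber G γ × γ ≤ ⌊ n + #degree2 G /2⌋
-- Positions end at `m`, one less than the order, so `3 ≤ n` becomes `1 < m` and a triangle lies on
-- `0 m`.
theorem3p5 (suc m) (s≤s 1<m) G ((π , nc) , max)
  with Triangulation.good-colouring (Positions.triangulation G π nc max) 1<m
... | c , good = Repair.γ×₂≤half G (c ∘ pos) λ v → Good⇒Covered nc max (good (pos≤m v))
  where open Positions G π
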